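{- Let $d,r\ge 1$ be integers, let $n=(d+1)(r-1)+1$, let $a_1,\ldots,a_r$ be integers with $a_i\le d+1$ for all $i$ and $\sum_{i=1}^r a_i=n$, and let $X\subset\mathbb{R}^d$ be a set obtained from these data by the construction described in the context. Then $X$ has exactly $[(r-1)!]^d$ different Tverberg partitions.
   Context: Construction of $X$. Let $e^1,\ldots,e^d$ be the standard basis of $\mathbb{R}^d$. For $1\le j\le d$ let $A_j=\{e^j,2e^j,\ldots,(r-1)e^j\}$. Since $\sum_{i=1}^r(d+1-a_i)=d$, one can choose for each $1\le j\le d$ an index $i(j)\in\{1,\ldots,r\}$ so that for all $1\le i\le r$, $\#\{1\le j\le d: i(j)=i\}=d+1-a_i$; fix any such choice. For $1\le i\le r$ and $1\le j\le d$ let $x^i_j=0$ if $i=i(j)$ and $x^i_j=-i$ otherwise, let $x^i=(x^i_1,\ldots,x^i_d)\in\mathbb{R}^d$, and let $A=\{x^1,\ldots,x^r\}$. Set $X=A\cup A_1\cup\cdots\cup A_d$; this is a disjoint union with $|A|=r$, $|A_j|=r-1$, so $|X|=n$. A Tverberg partition of $X$ is a partition of $X$ into $r$ pairwise disjoint subsets $X_1,\ldots,X_r$ (with union $X$) such that $\bigcap_{i=1}^r \mathrm{conv}(X_i)\neq\emptyset$, where $\mathrm{conv}$ denotes convex hull. When counting Tverberg partitions, partitions are unordered: two partitions differing only in the numbering of their parts are the same. -}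

module Defs where

open import Level using (0ℓ) renaming (suc to lsuc)
open import Algebra.Bundles.Raw using (RawMonoid)
open import Data.Bool.Base using (if_then_else_)
open import Data.Nat.Base as ℕ using (ℕ; _∸_)
import Data.Nat.Properties as ℕ
open import Data.Integer.Base as ℤ using (ℤ; +_)
open import Data.Rational.Base using (ℚ; 0ℚ; 1ℚ; ½; _+_; _-_; _*_; -_; 1/_; _/_; ∣_∣; _≤_; _<_; positive; nonNegative; Positive; NonZero)
open import Data.Rational.Properties
open import Data.Rational.Solver using (module +-*-Solver)
open import Data.Fin.Base using (Fin; toℕ)
import Data.Fin.Properties as Fin
open import Data.Fin.Permutation using (Permutation′; _⟨$⟩ʳ_; _⟨$⟩ˡ_; flip; _∘ₚ_; inverseʳ) renaming (id to idₚ)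
open import Data.List.Base using (length; filter; allFin)
open import Data.Product.Base using (∃; _×_; _,_)
open import Relation.Binary.Bundles using (Setoid)
open import Relation.Binary.Definitions using (_Respects_)
open import Relation.Binary.PropositionalEquality using (_≡_; refl; sym; trans; cong; subst)
open import Relation.Nullary.Decidable.Core using (does)
open import Relation.Unary using (Pred; _∈_; _≐_; _∪_; ⋃)
open import Relation.Unary.Properties using (≐-refl; ≐-sym; ≐-trans)

-- Cauchy sequences of rationals; the equality of real numbers is _≈ℝ_, not _≡_.
record ℝ : Set where
  field
    seq    : ℕ → ℚ
    cauchy : ∀ ε → 0ℚ < ε → ∃ λ N → ∀ m n → N ℕ.≤ m → N ℕ.≤ n → ∣ seq m - seq n ∣ < ε

open ℝ public

infix 4 _≈ℝ_ _≤ℝ_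

_≈ℝ_ : ℝ → ℝ → Set
x ≈ℝ y = ∀ ε → 0ℚ < ε → ∃ λ N → ∀ n → N ℕ.≤ n → ∣ seq x n - seq y n ∣ < ε

_≤ℝ_ : ℝ → ℝ → Set
x ≤ℝ y = ∀ ε → 0ℚ < ε → ∃ λ N → ∀ n → N ℕ.≤ n → seq x n < seq y n + ε

fromℚ : ℚ → ℝ
fromℚ q .seq _ = q
fromℚ q .cauchy ε 0<ε = 0 , λ _ _ _ _ → subst (λ p → ∣ p ∣ < ε) (sym (+-inverseʳ q)) 0<ε

fromℤ : ℤ → ℝ
fromℤ z = fromℚ (z / 1)

0ℝ 1ℝ : ℝ
0ℝ = fromℚ 0ℚ
1ℝ = fromℚ 1ℚ

abstract
  ½ε+½ε≡ε : ∀ ε → ½ * ε + ½ * ε ≡ ε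
  ½ε+½ε≡ε ε = trans (sym (*-distribʳ-+ ε ½ ½)) (*-identityˡ ε)

  half-pos : ∀ ε → 0ℚ < ε → 0ℚ < ½ * ε
  half-pos ε 0<ε = subst (_< ½ * ε) (*-zeroʳ ½) (*-monoʳ-<-pos ½ 0<ε)

  bounded : ∀ x → ∃ λ M → 0ℚ < M × ∃ λ N → ∀ n → N ℕ.≤ n → ∣ seq x n ∣ ≤ M
  bounded x with cauchy x 1ℚ (positive⁻¹ 1ℚ)
  ... | N , close = 1ℚ + ∣ seq x N ∣
      , +-mono-<-≤ (positive⁻¹ 1ℚ) (0≤∣p∣ (seq x N))
      , N , λ n N≤n → begin
          ∣ seq x n ∣                           ≡⟨ cong ∣_∣ (split (seq x n) (seq x N)) ⟩
          ∣ (seq x n - seq x N) + seq x N ∣     ≤⟨ ∣p+q∣≤∣p∣+∣q∣ (seq x n - seq x N) (seq x N) ⟩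
          ∣ seq x n - seq x N ∣ + ∣ seq x N ∣   ≤⟨ +-monoˡ-≤ ∣ seq x N ∣ (<⇒≤ (close n N N≤n ℕ.≤-refl)) ⟩
          1ℚ + ∣ seq x N ∣                      ∎
    where
    open ≤-Reasoning
    split : ∀ p q → p ≡ (p - q) + q
    split = solve 2 (λ p q → p := (p :- q) :+ q) refl
      where open +-*-Solver

infixl 6 _+ℝ_
infixl 7 _*ℝ_

_+ℝ_ : ℝ → ℝ → ℝ
(x +ℝ y) .seq n = seq x n + seq y n
(x +ℝ y) .cauchy ε 0<ε with cauchy x (½ * ε) (half-pos ε 0<ε) | cauchy y (½ * ε) (half-pos ε 0<ε)
... | N₁ , close₁ | N₂ , close₂ = N₁ ℕ.⊔ N₂ , λ m n N≤m N≤n → begin-strict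
    ∣ (seq x m + seq y m) - (seq x n + seq y n) ∣
      ≡⟨ cong ∣_∣ (regroup (seq x m) (seq y m) (seq x n) (seq y n)) ⟩
    ∣ (seq x m - seq x n) + (seq y m - seq y n) ∣
      ≤⟨ ∣p+q∣≤∣p∣+∣q∣ (seq x m - seq x n) (seq y m - seq y n) ⟩
    ∣ seq x m - seq x n ∣ + ∣ seq y m - seq y n ∣
      <⟨ +-mono-< (close₁ m n (ℕ.m⊔n≤o⇒m≤o N₁ N₂ N≤m) (ℕ.m⊔n≤o⇒m≤o N₁ N₂ N≤n))
                  (close₂ m n (ℕ.m⊔n≤o⇒n≤o N₁ N₂ N≤m) (ℕ.m⊔n≤o⇒n≤o N₁ N₂ N≤n)) ⟩
    ½ * ε + ½ * ε
      ≡⟨ ½ε+½ε≡ε ε ⟩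
    ε ∎
  where
  open ≤-Reasoning
  regroup : ∀ a b c d → (a + b) - (c + d) ≡ (a - c) + (b - d)
  regroup = solve 4 (λ a b c d → (a :+ b) :- (c :+ d) := (a :- c) :+ (b :- d)) refl
    where open +-*-Solver

abstract
  scale : ∀ K ε → 0ℚ < K → 0ℚ < ε → ∃ λ δ → 0ℚ < δ × K * δ ≡ ε
  scale K ε 0<K 0<ε = K⁻¹ * ε , positive⁻¹ (K⁻¹ * ε) {{pos*pos⇒pos K⁻¹ {{1/pos⇒pos K}} ε {{positive 0<ε}}}} ,
    trans (sym (*-assoc K K⁻¹ ε)) (trans (cong (_* ε) (*-inverseʳ K)) (*-identityˡ ε))
    where
    instance
      K>0 : Positive K
      K>0 = positive 0<K
      K≢0 : NonZero K
      K≢0 = pos⇒nonZero K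
    K⁻¹ : ℚ
    K⁻¹ = 1/ K

  ∣ab∣<Bδ : ∀ a b B δ → 0ℚ < B → ∣ a ∣ ≤ B → ∣ b ∣ < δ → ∣ a * b ∣ < B * δ
  ∣ab∣<Bδ a b B δ 0<B a≤B b<δ = begin-strict
    ∣ a * b ∣      ≡⟨ ∣p*q∣≡∣p∣*∣q∣ a b ⟩
    ∣ a ∣ * ∣ b ∣  ≤⟨ *-monoʳ-≤-nonNeg ∣ b ∣ {{nonNegative (0≤∣p∣ b)}} a≤B ⟩
    B * ∣ b ∣      <⟨ *-monoʳ-<-pos B {{positive 0<B}} b<δ ⟩
    B * δ          ∎
    where open ≤-Reasoning

  product-close : ∀ a b c d M L δ → 0ℚ < M → 0ℚ < L → ∣ a ∣ ≤ M → ∣ d ∣ ≤ L →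
                  ∣ a - c ∣ < δ → ∣ b - d ∣ < δ → ∣ a * b - c * d ∣ < (M + L) * δ
  product-close a b c d M L δ 0<M 0<L a≤M d≤L a~c b~d = begin-strict
    ∣ a * b - c * d ∣                    ≡⟨ cong ∣_∣ (regroup a b c d) ⟩
    ∣ a * (b - d) + d * (a - c) ∣        ≤⟨ ∣p+q∣≤∣p∣+∣q∣ (a * (b - d)) (d * (a - c)) ⟩
    ∣ a * (b - d) ∣ + ∣ d * (a - c) ∣    <⟨ +-mono-< (∣ab∣<Bδ a (b - d) M δ 0<M a≤M b~d)
                                                     (∣ab∣<Bδ d (a - c) L δ 0<L d≤L a~c) ⟩
    M * δ + L * δ                        ≡⟨ *-distribʳ-+ δ M L ⟨
    (M + L) * δ                          ∎
    where
    open ≤-Reasoning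
    regroup : ∀ a b c d → a * b - c * d ≡ a * (b - d) + d * (a - c)
    regroup = solve 4 (λ a b c d → a :* b :- c :* d := a :* (b :- d) :+ d :* (a :- c)) refl
      where open +-*-Solver

_*ℝ_ : ℝ → ℝ → ℝ
(x *ℝ y) .seq n = seq x n * seq y n
(x *ℝ y) .cauchy ε 0<ε =
  let
    M , 0<M , N₁ , x≤M = bounded x
    L , 0<L , N₂ , y≤L = bounded y
    δ , 0<δ , Kδ≡ε     = scale (M + L) ε (+-mono-< 0<M 0<L) 0<ε
    N₃ , close₃        = cauchy x δ 0<δ
    N₄ , close₄        = cauchy y δ 0<δ
  in (N₁ ℕ.⊔ N₂) ℕ.⊔ (N₃ ℕ.⊔ N₄) , λ m n N≤m N≤n →
    let
      N₁₂≤m = ℕ.m⊔n≤o⇒m≤o (N₁ ℕ.⊔ N₂) (N₃ ℕ.⊔ N₄) N≤m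
      N₁₂≤n = ℕ.m⊔n≤o⇒m≤o (N₁ ℕ.⊔ N₂) (N₃ ℕ.⊔ N₄) N≤n
      N₃₄≤m = ℕ.m⊔n≤o⇒n≤o (N₁ ℕ.⊔ N₂) (N₃ ℕ.⊔ N₄) N≤m
      N₃₄≤n = ℕ.m⊔n≤o⇒n≤o (N₁ ℕ.⊔ N₂) (N₃ ℕ.⊔ N₄) N≤n
    in subst (∣ seq x m * seq y m - seq x n * seq y n ∣ <_) Kδ≡ε
      (product-close (seq x m) (seq y m) (seq x n) (seq y n) M L δ 0<M 0<L
        (x≤M m (ℕ.m⊔n≤o⇒m≤o N₁ N₂ N₁₂≤m))
        (y≤L n (ℕ.m⊔n≤o⇒n≤o N₁ N₂ N₁₂≤n))
        (close₃ m n (ℕ.m⊔n≤o⇒m≤o N₃ N₄ N₃₄≤m) (ℕ.m⊔n≤o⇒m≤o N₃ N₄ N₃₄≤n))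
        (close₄ m n (ℕ.m⊔n≤o⇒n≤o N₃ N₄ N₃₄≤m) (ℕ.m⊔n≤o⇒n≤o N₃ N₄ N₃₄≤n)))

+ℝ-0-rawMonoid : RawMonoid 0ℓ 0ℓ
+ℝ-0-rawMonoid = record { Carrier = ℝ ; _≈_ = _≈ℝ_ ; _∙_ = _+ℝ_ ; ε = 0ℝ }

open import Algebra.Definitions.RawMonoid +ℝ-0-rawMonoid public
  using () renaming (sum to sumℝ)
open import Algebra.Definitions.RawMonoid ℤ.+-0-rawMonoid public
  using () renaming (sum to sumℤ)

Point : ℕ → Set
Point d = Fin d → ℝ

infix 4 _≋_

_≋_ : ∀ {d} → Point d → Point d → Set
p ≋ q = ∀ j → p j ≈ℝ q j

conv : ∀ {d} → Pred (Point d) 0ℓ → Pred (Point d) 0ℓ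
conv {d} S p =
  ∃ λ (m : ℕ) → ∃ λ (s : Fin m → Point d) → ∃ λ (w : Fin m → ℝ) →
    (∀ k → s k ∈ S) ×
    (∀ k → 0ℝ ≤ℝ w k) ×
    sumℝ w ≈ℝ 1ℝ ×
    p ≋ (λ j → sumℝ (λ k → w k *ℝ s k j))

-- A subset of ℝᵈ is a predicate that respects the equality of points;
-- hence the condition `respects` on the parts.
record TverbergPartition {d} (r : ℕ) (X : Pred (Point d) 0ℓ) : Set (lsuc 0ℓ) where
  field
    part     : Fin r → Pred (Point d) 0ℓ
    respects : ∀ i → part i Respects _≋_
    disjoint : ∀ {i i′ p} → p ∈ part i → p ∈ part i′ → i ≡ i′
    union    : ⋃ (Fin r) part ≐ X
    common   : ∃ λ p → ∀ i → p ∈ conv (part i)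

open TverbergPartition public

infix 4 _∼_

-- Equality of unordered partitions: equal up to renumbering the parts.
_∼_ : ∀ {d r} {X : Pred (Point d) 0ℓ} → TverbergPartition r X → TverbergPartition r X → Set
_∼_ {r = r} P Q = ∃ λ (π : Permutation′ r) → ∀ i → part P i ≐ part Q (π ⟨$⟩ʳ i)

TverbergPartitions : ∀ {d} → ℕ → Pred (Point d) 0ℓ → Setoid (lsuc 0ℓ) 0ℓ
TverbergPartitions r X = record
  { Carrier       = TverbergPartition r X
  ; _≈_           = _∼_
  ; isEquivalence = record
    { refl  = idₚ , λ _ → ≐-refl
    ; sym   = λ {P} {Q} (π , P≐Q) → flip π , λ i →
        ≐-sym (subst (λ k → part P (π ⟨$⟩ˡ i) ≐ part Q k) (inverseʳ π) (P≐Q (π ⟨$⟩ˡ i)))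
    ; trans = λ (π , P≐Q) (ρ , Q≐R) → π ∘ₚ ρ , λ i → ≐-trans (P≐Q i) (Q≐R (π ⟨$⟩ʳ i))
    }
  }

-- Indices 1, …, r are represented by Fin r; this recovers the integer i.
index : ∀ {r} → Fin r → ℤ
index i = + ℕ.suc (toℕ i)

basis : ∀ {d} → Fin d → Point d
basis j j′ = if does (j Fin.≟ j′) then 1ℝ else 0ℝ

-- c j is the chosen index i(j).
module Construction {d r : ℕ} (c : Fin d → Fin r) where

  Aⱼ : Fin d → Pred (Point d) 0ℓ
  Aⱼ j p = ∃ λ (k : ℕ) → 1 ℕ.≤ k × k ℕ.≤ r ∸ 1 × p ≋ (λ j′ → fromℤ (+ k) *ℝ basis j j′)

  x : Fin r → Point d
  x i j = if does (i Fin.≟ c j) then 0ℝ else fromℤ (ℤ.- index i)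

  A : Pred (Point d) 0ℓ
  A p = ∃ λ (i : Fin r) → p ≋ x i

  X : Pred (Point d) 0ℓ
  X = A ∪ ⋃ (Fin d) Aⱼ

#fibre : ∀ {d r} → (Fin d → Fin r) → Fin r → ℕ
#fibre {d} c i = length (filter (λ j → c j Fin.≟ i) (allFin d))

module Submission where

-- A Tverberg partition with common point p is handled through the labels of the points of X, so that
-- every case distinction is decidable; only bounds on the coordinates of p are needed.
-- Since |A_j| = r − 1, some part misses A_j, whence p_j ≤ 0. A part missing A would force Σ_j p_j ≥ 1;
-- so each part contains exactly one xⁱ, and the part of x^{i(j)} gives p_j ≥ 0, i.e. p = 0. For
-- i ≠ i(j) the coordinate xⁱ_j is negative, so the part of xⁱ needs a point of A_j to reach 0, hence
-- contains exactly one. Conversely, any choice of bijections A_j → {i ≠ i(j)} puts 0 in the hull of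
-- every part, which leaves (r − 1)! choices for each j.

open import Defs
open import Level using (0ℓ)
open import Algebra.Bundles using (CommutativeRing)
open import Data.Bool.Base using (if_then_else_)
open import Data.Bool.Properties using (if-float)
open import Data.Nat.Base as ℕ using (ℕ; zero; suc; _∸_; _^_; _!)
import Data.Nat.Properties as ℕ
open import Data.Nat.Coprimality using (1-coprimeTo) renaming (sym to coprime-sym)
open import Data.Integer.Base as ℤ using (ℤ; +_)
import Data.Integer.Properties as ℤ
open import Data.Rational.Base using (ℚ; mkℚ; 0ℚ; 1ℚ; ½; _+_; _-_; _*_; -_; 1/_; _/_; ∣_∣; _≤_; _<_; *≤*; positive; nonNegative; Positive; NonZero)
import Data.Rational.Properties as ℚ
open import Data.Rational.Solver using (module +-*-Solver)
open import Algebra.Properties.Group ℚ.+-0-group using () renaming (⁻¹-involutive to neg-involutive)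
open import Algebra.Properties.Semiring.Sum (CommutativeRing.semiring ℚ.+-*-commutativeRing)
  using (sum; sum-cong-≗; *-distribˡ-sum; *-distribʳ-sum; ∑-distrib-+; ∑-comm; sum-replicate-zero)
open import Data.Fin.Base using (Fin; zero; suc; punchIn; punchOut; toℕ; fromℕ<; combine; quotient; remainder; finToFun; funToFin)
import Data.Fin.Properties as Fin
open import Data.Fin.Permutation as Perm using (Permutation′; permutation; _⟨$⟩ʳ_; _⟨$⟩ˡ_; inverseˡ; inverseʳ; insert; remove; insert-punchIn; insert-remove)
open import Data.Product.Base using (∃; _×_; _,_; proj₁; proj₂)
open import Data.Sum.Base using (_⊎_; inj₁; inj₂)
open import Function.Base using (_∘_; id)
open import Function.Bundles using (Bijection)
open import Function.Definitions using (Injective)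
open import Relation.Binary.Bundles using (Setoid)
open import Relation.Binary.PropositionalEquality using (_≡_; _≢_; refl; sym; trans; cong; cong₂; subst; subst₂; setoid; module ≡-Reasoning)
import Relation.Binary.Reasoning.Base.Single
open import Relation.Nullary.Decidable using (does; yes; no; dec-true; dec-false)
open import Relation.Nullary.Negation using (¬_; contradiction)
open import Relation.Unary using (Pred; _∈_)

-- Finite sets: pigeonhole arguments and the numbering of permutations

injective⇒surjective : ∀ {n} {f : Fin n → Fin n} → Injective _≡_ _≡_ f → ∀ y → ∃ λ x → f x ≡ y
injective⇒surjective {suc n} {f} inj y with Fin.any? (λ x → f x Fin.≟ y)
... | yes hit = hit
-- If `y` is missed, punching it out of the values of `f` injects `Fin (suc n)` into `Fin n`.
... | no miss = contradiction
  (Fin.injective⇒≤ λ {x} {x′} → inj ∘ Fin.punchOut-injective (y≢ x) (y≢ x′)) ℕ.1+n≰n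
  where
  y≢ : ∀ x → y ≢ f x
  y≢ x y≡fx = miss (x , sym y≡fx)

-- A choice `g` of preimages satisfies h ∘ g = q, so it is injective because `q` is, hence a
-- permutation of `Fin n`; π is its inverse. Thus `h` lists the values of `q`, each exactly once.
covers⇒permutation : ∀ {n} {B : Set} (h q : Fin n → B) → Injective _≡_ _≡_ q →
                     (∀ i → ∃ λ k → h k ≡ q i) →
                     ∃ λ (π : Permutation′ n) → ∀ k → h k ≡ q (π ⟨$⟩ʳ k)
covers⇒permutation {n} h q q-inj cover = permutation f g f∘g g∘f , λ k →
    trans (cong h (sym (g∘f k))) (h∘g (f k))
  where
  g : Fin n → Fin n
  g = proj₁ ∘ cover
  h∘g : ∀ i → h (g i) ≡ q i
  h∘g = proj₂ ∘ cover
  g-inj : Injective _≡_ _≡_ g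
  g-inj {i} {i′} gi≡gi′ = q-inj (trans (sym (h∘g i)) (trans (cong h gi≡gi′) (h∘g i′)))
  f : Fin n → Fin n
  f = proj₁ ∘ injective⇒surjective g-inj
  g∘f : ∀ k → g (f k) ≡ k
  g∘f = proj₂ ∘ injective⇒surjective g-inj
  f∘g : ∀ i → f (g i) ≡ i
  f∘g i = g-inj (g∘f (g i))

-- If every label were hit, a choice of preimages would inject `Fin (suc m)` into `Fin m`. This is
-- used to find a part that contains no point of a given A_j.
misses : ∀ {m} (f : Fin m → Fin (suc m)) → ∃ λ y → ∀ x → f x ≢ y
misses {m} f =
  let y , y∉ = Fin.¬∀⟶∃¬ (suc m) _ (λ y → Fin.any? λ x → f x Fin.≟ y) λ hit →
        ℕ.1+n≰n (Fin.injective⇒≤ {f = proj₁ ∘ hit} λ {y} {y′} eq →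
          trans (sym (proj₂ (hit y))) (trans (cong f eq) (proj₂ (hit y′))))
  in y , λ x fx≡y → y∉ (x , fx≡y)

-- Factorial number system: the quotient by `n !` is the image of `zero`, and the remainder codes
-- the permutation induced on the other elements.
toPermutation : ∀ n → Fin (n !) → Permutation′ n
toPermutation zero    _ = Perm.id
toPermutation (suc n) a = insert zero (quotient (n !) a) (toPermutation n (remainder {suc n} (n !) a))

toPermutation-injective : ∀ n {a b} → toPermutation n a Perm.≈ toPermutation n b → a ≡ b
toPermutation-injective zero    {zero} {zero} _ = refl
toPermutation-injective (suc n) {a} {b} a≈b = begin
  a                         ≡⟨ Fin.combine-remQuot {suc n} (n !) a ⟨
  combine (quot a) (rem a)  ≡⟨ cong₂ combine (a≈b zero) (toPermutation-injective n tails≈) ⟩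
  combine (quot b) (rem b)  ≡⟨ Fin.combine-remQuot {suc n} (n !) b ⟩
  b                         ∎
  where
  open ≡-Reasoning
  quot : Fin (suc n !) → Fin (suc n)
  quot = quotient (n !)
  rem : Fin (suc n !) → Fin (n !)
  rem = remainder {suc n} (n !)
  tail : Fin (suc n !) → Permutation′ n
  tail = toPermutation n ∘ rem
  tails≈ : tail a Perm.≈ tail b
  -- The images of `zero` agree, so both tails can be compared behind the same injective `punchIn`.
  tails≈ k = Fin.punchIn-injective (quot a) _ _ (begin
    punchIn (quot a) (tail a ⟨$⟩ʳ k)    ≡⟨ insert-punchIn zero (quot a) (tail a) k ⟨
    toPermutation (suc n) a ⟨$⟩ʳ suc k  ≡⟨ a≈b (suc k) ⟩
    toPermutation (suc n) b ⟨$⟩ʳ suc k  ≡⟨ insert-punchIn zero (quot b) (tail b) k ⟩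
    punchIn (quot b) (tail b ⟨$⟩ʳ k)    ≡⟨ cong (λ i → punchIn i (tail b ⟨$⟩ʳ k)) (a≈b zero) ⟨
    punchIn (quot a) (tail b ⟨$⟩ʳ k)    ∎)

insert-cong : ∀ {n} i j {π ρ : Permutation′ n} → π Perm.≈ ρ → insert i j π Perm.≈ insert i j ρ
insert-cong i j π≈ρ k with i Fin.≟ k
... | yes _  = refl
... | no i≢k = cong (punchIn j) (π≈ρ (punchOut i≢k))

toPermutation-surjective : ∀ n (π : Permutation′ n) → ∃ λ a → toPermutation n a Perm.≈ π
toPermutation-surjective zero    π = zero , λ ()
toPermutation-surjective (suc n) π with toPermutation-surjective n (remove zero π)
... | a , a≈ = combine (π ⟨$⟩ʳ zero) a , λ k → begin
  toPermutation (suc n) (combine (π ⟨$⟩ʳ zero) a) ⟨$⟩ʳ k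
    ≡⟨ cong (λ (i , b) → insert zero i (toPermutation n b) ⟨$⟩ʳ k)
            (Fin.remQuot-combine {suc n} (π ⟨$⟩ʳ zero) a) ⟩
  insert zero (π ⟨$⟩ʳ zero) (toPermutation n a) ⟨$⟩ʳ k
    ≡⟨ insert-cong zero (π ⟨$⟩ʳ zero) {toPermutation n a} {remove zero π} a≈ k ⟩
  insert zero (π ⟨$⟩ʳ zero) (remove zero π) ⟨$⟩ʳ k
    ≡⟨ insert-remove zero π k ⟩
  π ⟨$⟩ʳ k ∎
  where open ≡-Reasoning

funToFin-cong : ∀ {m n} {f g : Fin m → Fin n} → (∀ i → f i ≡ g i) → funToFin f ≡ funToFin g
funToFin-cong {zero}  f≗g = refl
funToFin-cong {suc m} f≗g = cong₂ combine (f≗g zero) (funToFin-cong (f≗g ∘ suc))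

-- The `d` digits of the code in base `n !` number one permutation for each axis.
toPermutations : ∀ n d → Fin ((n !) ^ d) → Fin d → Permutation′ n
toPermutations n d z j = toPermutation n (finToFun z j)

toPermutations-injective : ∀ n d {y z} →
  (∀ j → toPermutations n d y j Perm.≈ toPermutations n d z j) → y ≡ z
toPermutations-injective n d {y} {z} y≈z = begin
  y                                ≡⟨ Fin.funToFin-finToFin {d} {n !} y ⟨
  funToFin (finToFun {n !} {d} y)  ≡⟨ funToFin-cong (λ j → toPermutation-injective n (y≈z j)) ⟩
  funToFin (finToFun {n !} {d} z)  ≡⟨ Fin.funToFin-finToFin {d} {n !} z ⟩
  z                                ∎
  where open ≡-Reasoning

toPermutations-surjective : ∀ n d (π : Fin d → Permutation′ n) →
  ∃ λ z → ∀ j → toPermutations n d z j Perm.≈ π j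
toPermutations-surjective n d π = funToFin code , λ j k →
    trans (cong (λ a → toPermutation n a ⟨$⟩ʳ k) (Fin.finToFun-funToFin code j))
          (proj₂ (toPermutation-surjective n (π j)) k)
  where
  code : Fin d → Fin (n !)
  code j = proj₁ (toPermutation-surjective n (π j))

-- Order on sequences of rationals and convex combinations

infix 4 _≲_ _≃_

-- x ≤ℝ y unfolds to seq x ≲ seq y; dropping the Cauchy condition spares its proof for intermediate sequences.
_≲_ : (ℕ → ℚ) → (ℕ → ℚ) → Set
x ≲ y = ∀ ε → 0ℚ < ε → ∃ λ N → ∀ n → N ℕ.≤ n → x n < y n + ε

_≃_ : (ℕ → ℚ) → (ℕ → ℚ) → Set
x ≃ y = x ≲ y × y ≲ x

const : ℚ → ℕ → ℚ
const q _ = q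

≤⇒≲ : ∀ {x y} → (∀ n → x n ≤ y n) → x ≲ y
≤⇒≲ {x} {y} x≤y ε 0<ε = 0 , λ n _ → begin-strict
  x n        ≤⟨ x≤y n ⟩
  y n        ≡⟨ ℚ.+-identityʳ (y n) ⟨
  y n + 0ℚ   <⟨ ℚ.+-monoʳ-< (y n) 0<ε ⟩
  y n + ε    ∎
  where open ℚ.≤-Reasoning

≲-trans : ∀ {x y z} → x ≲ y → y ≲ z → x ≲ z
≲-trans {x} {y} {z} x≲y y≲z ε 0<ε
  with x≲y (½ * ε) (half-pos ε 0<ε) | y≲z (½ * ε) (half-pos ε 0<ε)
... | N₁ , x<y | N₂ , y<z = N₁ ℕ.⊔ N₂ , λ n N≤n → begin-strict
  x n                        <⟨ x<y n (ℕ.m⊔n≤o⇒m≤o N₁ N₂ N≤n) ⟩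
  y n + ½ * ε                <⟨ ℚ.+-monoˡ-< (½ * ε) (y<z n (ℕ.m⊔n≤o⇒n≤o N₁ N₂ N≤n)) ⟩
  (z n + ½ * ε) + ½ * ε      ≡⟨ ℚ.+-assoc (z n) (½ * ε) (½ * ε) ⟩
  z n + (½ * ε + ½ * ε)      ≡⟨ cong (_+_ (z n)) (½ε+½ε≡ε ε) ⟩
  z n + ε                    ∎
  where open ℚ.≤-Reasoning

≗⇒≲ : ∀ {x y} → (∀ n → x n ≡ y n) → x ≲ y
≗⇒≲ x≗y = ≤⇒≲ (ℚ.≤-reflexive ∘ x≗y)

module ≲-Reasoning = Relation.Binary.Reasoning.Base.Single _≲_
  (λ {x} → ≤⇒≲ {x} λ _ → ℚ.≤-refl) (λ {x} {y} {z} → ≲-trans {x} {y} {z})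

≲-+ : ∀ {x y x′ y′} → x ≲ y → x′ ≲ y′ → (λ n → x n + x′ n) ≲ (λ n → y n + y′ n)
≲-+ {x} {y} {x′} {y′} x≲y x′≲y′ ε 0<ε
  with x≲y (½ * ε) (half-pos ε 0<ε) | x′≲y′ (½ * ε) (half-pos ε 0<ε)
... | N₁ , x<y | N₂ , x′<y′ = N₁ ℕ.⊔ N₂ , λ n N≤n → begin-strict
  x n + x′ n                          <⟨ ℚ.+-mono-< (x<y n (ℕ.m⊔n≤o⇒m≤o N₁ N₂ N≤n)) (x′<y′ n (ℕ.m⊔n≤o⇒n≤o N₁ N₂ N≤n)) ⟩
  (y n + ½ * ε) + (y′ n + ½ * ε)      ≡⟨ regroup (y n) (y′ n) (½ * ε) ⟩
  (y n + y′ n) + (½ * ε + ½ * ε)      ≡⟨ cong (_+_ (y n + y′ n)) (½ε+½ε≡ε ε) ⟩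
  (y n + y′ n) + ε                    ∎
  where
  open ℚ.≤-Reasoning
  regroup : ∀ a b c → (a + c) + (b + c) ≡ (a + b) + (c + c)
  regroup = solve 3 (λ a b c → (a :+ c) :+ (b :+ c) := (a :+ b) :+ (c :+ c)) refl
    where open +-*-Solver

≲-neg : ∀ {x y} → x ≲ y → (λ n → - y n) ≲ (λ n → - x n)
≲-neg {x} {y} x≲y ε 0<ε with x≲y ε 0<ε
... | N , x<y = N , λ n N≤n → subst₂ _<_ (left (x n) (y n)) (right (x n) (y n) ε)
    (ℚ.+-monoˡ-< (- x n + - y n) (x<y n N≤n))
  where
  open +-*-Solver
  left : ∀ a b → a + (- a + - b) ≡ - b
  left = solve 2 (λ a b → a :+ (:- a :+ :- b) := :- b) refl
  right : ∀ a b e → (b + e) + (- a + - b) ≡ - a + e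
  right = solve 3 (λ a b e → (b :+ e) :+ (:- a :+ :- b) := :- a :+ e) refl

≲-scale : ∀ {x y} q → 0ℚ ≤ q → x ≲ y → (λ n → q * x n) ≲ (λ n → q * y n)
≲-scale {x} {y} q 0≤q x≲y ε 0<ε =
  -- The tolerance is ε / (1 + q) rather than ε / q, so that `q` may be zero and the inequality
  -- stays strict.
  let 1+q>0 = ℚ.+-mono-<-≤ (ℚ.positive⁻¹ 1ℚ) 0≤q
      δ , 0<δ , Kδ≡ε = scale (1ℚ + q) ε 1+q>0 0<ε
      N , x<y = x≲y δ 0<δ
  in N , λ n N≤n → begin-strict
    q * x n                  ≤⟨ ℚ.*-monoˡ-≤-nonNeg q {{nonNegative 0≤q}} (ℚ.<⇒≤ (x<y n N≤n)) ⟩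
    q * (y n + δ)            ≡⟨ ℚ.+-identityˡ _ ⟨
    0ℚ + q * (y n + δ)       <⟨ ℚ.+-monoˡ-< (q * (y n + δ)) 0<δ ⟩
    δ + q * (y n + δ)        ≡⟨ regroup (y n) q δ ⟩
    q * y n + (1ℚ + q) * δ   ≡⟨ cong (_+_ (q * y n)) Kδ≡ε ⟩
    q * y n + ε              ∎
  where
  open ℚ.≤-Reasoning
  regroup : ∀ a q δ → δ + q * (a + δ) ≡ q * a + (1ℚ + q) * δ
  regroup = solve 3 (λ a q δ → δ :+ q :* (a :+ δ) := q :* a :+ (con 1ℚ :+ q) :* δ) refl
    where open +-*-Solver

≲-sum : ∀ {m} {x y : Fin m → ℕ → ℚ} → (∀ k → x k ≲ y k) →
        (λ n → sum (λ k → x k n)) ≲ (λ n → sum (λ k → y k n))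
≲-sum {zero}  x≲y = ≤⇒≲ λ _ → ℚ.≤-refl
≲-sum {suc m} {x} {y} x≲y = ≲-+ {x = x zero} {y zero} (x≲y zero) (≲-sum (x≲y ∘ suc))

≲-const : ∀ {a b} → const a ≲ const b → a ≤ b
-- If b < a, the tolerance a - b gives a < b + (a - b) = a.
≲-const {a} {b} a≲b = ℚ.≮⇒≥ λ b<a →
  let N , a<a = a≲b (a - b) (subst (_< a - b) (ℚ.+-inverseʳ b) (ℚ.+-monoˡ-< (- b) b<a))
  in ℚ.<-irrefl (sym (cancel a b)) (a<a N ℕ.≤-refl)
  where
  cancel : ∀ a b → b + (a - b) ≡ a
  cancel = solve 2 (λ a b → b :+ (a :- b) := a) refl
    where open +-*-Solver

≗⇒≃ : ∀ {x y} → (∀ n → x n ≡ y n) → x ≃ y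
≗⇒≃ x≗y = ≗⇒≲ x≗y , ≗⇒≲ (sym ∘ x≗y)

≃-sym : ∀ {x y} → x ≃ y → y ≃ x
≃-sym (x≲y , y≲x) = y≲x , x≲y

≃-trans : ∀ {x y z} → x ≃ y → y ≃ z → x ≃ z
≃-trans {x} {y} {z} (x≲y , y≲x) (y≲z , z≲y) = ≲-trans {x} {y} {z} x≲y y≲z , ≲-trans {z} {y} {x} z≲y y≲x

≃-+ : ∀ {x y x′ y′} → x ≃ y → x′ ≃ y′ → (λ n → x n + x′ n) ≃ (λ n → y n + y′ n)
≃-+ {x} {y} {x′} {y′} (x≲y , y≲x) (x′≲y′ , y′≲x′) =
  ≲-+ {x} {y} {x′} {y′} x≲y x′≲y′ , ≲-+ {y} {x} {y′} {x′} y≲x y′≲x′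

≃-neg : ∀ {x y} → x ≃ y → (λ n → - x n) ≃ (λ n → - y n)
≃-neg {x} {y} (x≲y , y≲x) = ≲-neg {y} {x} y≲x , ≲-neg {x} {y} x≲y

≃-scale : ∀ {x y} q → 0ℚ ≤ q → x ≃ y → (λ n → q * x n) ≃ (λ n → q * y n)
≃-scale {x} {y} q 0≤q (x≲y , y≲x) = ≲-scale {x} {y} q 0≤q x≲y , ≲-scale {y} {x} q 0≤q y≲x

≃-sum : ∀ {m} {x y : Fin m → ℕ → ℚ} → (∀ k → x k ≃ y k) →
        (λ n → sum (λ k → x k n)) ≃ (λ n → sum (λ k → y k n))
≃-sum x≃y = ≲-sum (proj₁ ∘ x≃y) , ≲-sum (proj₂ ∘ x≃y)

-<⇒<+ : ∀ {a b ε} → a - b < ε → a < b + ε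
-<⇒<+ {a} {b} {ε} a-b<ε = subst (_< b + ε) (cancel a b) (ℚ.+-monoʳ-< b a-b<ε)
  where
  cancel : ∀ a b → b + (a - b) ≡ a
  cancel = solve 2 (λ a b → b :+ (a :- b) := a) refl
    where open +-*-Solver

<+⇒-< : ∀ {a b ε} → a < b + ε → a - b < ε
<+⇒-< {a} {b} {ε} a<b+ε = subst (a - b <_) (cancel b ε) (ℚ.+-monoˡ-< (- b) a<b+ε)
  where
  cancel : ∀ b e → (b + e) - b ≡ e
  cancel = solve 2 (λ b e → (b :+ e) :- b := e) refl
    where open +-*-Solver

neg-sub : ∀ a b → - (a - b) ≡ b - a
neg-sub = solve 2 (λ a b → :- (a :- b) := b :- a) refl
  where open +-*-Solver

p≤∣p∣ : ∀ p → p ≤ ∣ p ∣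
p≤∣p∣ p with ℚ.≤-total 0ℚ p
... | inj₁ 0≤p = ℚ.≤-reflexive (sym (ℚ.0≤p⇒∣p∣≡p 0≤p))
... | inj₂ p≤0 = ℚ.≤-trans p≤0 (ℚ.0≤∣p∣ p)

∣-∣<⇒< : ∀ {a b ε} → ∣ a - b ∣ < ε → a < b + ε
∣-∣<⇒< {a} {b} = -<⇒<+ {a} {b} ∘ ℚ.≤-<-trans (p≤∣p∣ (a - b))

-- Equality of reals and of points, and points with rational coordinates

≈ℝ⇒≃ : ∀ x y → x ≈ℝ y → seq x ≃ seq y
≈ℝ⇒≃ x y x≈y = (λ ε 0<ε → let N , close = x≈y ε 0<ε in N , λ n → ∣-∣<⇒< {seq x n} {seq y n} ∘ close n)
  , λ ε 0<ε → let N , close = x≈y ε 0<ε in N , λ n N≤n → ∣-∣<⇒< {seq y n} {seq x n}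
      (subst (_< ε) (trans (sym (ℚ.∣-p∣≡∣p∣ (seq x n - seq y n))) (cong ∣_∣ (neg-sub (seq x n) (seq y n))))
             (close n N≤n))

≃⇒≈ℝ : ∀ x y → seq x ≃ seq y → x ≈ℝ y
≃⇒≈ℝ x y (x≲y , y≲x) ε 0<ε =
  let N₁ , x<y = x≲y ε 0<ε
      N₂ , y<x = y≲x ε 0<ε
  in N₁ ℕ.⊔ N₂ , λ n N≤n → abs< (seq x n) (seq y n)
       (x<y n (ℕ.m⊔n≤o⇒m≤o N₁ N₂ N≤n)) (y<x n (ℕ.m⊔n≤o⇒n≤o N₁ N₂ N≤n))
  where
  abs< : ∀ a b → a < b + ε → b < a + ε → ∣ a - b ∣ < ε
  abs< a b a<b b<a with ℚ.∣p∣≡p∨∣p∣≡-p (a - b)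
  ... | inj₁ eq = subst (_< ε) (sym eq) (<+⇒-< {a} {b} a<b)
  ... | inj₂ eq = subst (_< ε) (sym (trans eq (neg-sub a b))) (<+⇒-< {b} {a} b<a)

≋-refl : ∀ {d} (p : Point d) → p ≋ p
≋-refl p j = ≃⇒≈ℝ (p j) (p j) (≗⇒≃ λ _ → refl)

≋-sym : ∀ {d} (p q : Point d) → p ≋ q → q ≋ p
≋-sym p q p≋q j = ≃⇒≈ℝ (q j) (p j) (≃-sym {seq (p j)} {seq (q j)} (≈ℝ⇒≃ (p j) (q j) (p≋q j)))

≋-trans : ∀ {d} (p q s : Point d) → p ≋ q → q ≋ s → p ≋ s
≋-trans p q s p≋q q≋s j = ≃⇒≈ℝ (p j) (s j)
  (≃-trans {seq (p j)} {seq (q j)} {seq (s j)} (≈ℝ⇒≃ (p j) (q j) (p≋q j)) (≈ℝ⇒≃ (q j) (s j) (q≋s j)))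

*ℝ-congˡ : ∀ w x y → x ≈ℝ y → w *ℝ x ≈ℝ w *ℝ y
*ℝ-congˡ w x y x≈y ε 0<ε =
  -- `M` eventually bounds |w|, so closeness of `x` and `y` within δ = ε / M suffices.
  let M , 0<M , N₁ , w≤M = bounded w
      δ , 0<δ , Mδ≡ε = scale M ε 0<M 0<ε
      N₂ , close = x≈y δ 0<δ
  in N₁ ℕ.⊔ N₂ , λ n N≤n → subst₂ _<_ (cong ∣_∣ (factor (seq w n) (seq x n) (seq y n))) Mδ≡ε
      (∣ab∣<Bδ (seq w n) (seq x n - seq y n) M δ 0<M
        (w≤M n (ℕ.m⊔n≤o⇒m≤o N₁ N₂ N≤n)) (close n (ℕ.m⊔n≤o⇒n≤o N₁ N₂ N≤n)))
  where
  factor : ∀ w a b → w * (a - b) ≡ w * a - w * b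
  factor = solve 3 (λ w a b → w :* (a :- b) := w :* a :- w :* b) refl
    where open +-*-Solver

seq-sumℝ : ∀ {m} (t : Fin m → ℝ) n → seq (sumℝ t) n ≡ sum (λ k → seq (t k) n)
seq-sumℝ {zero}  t n = refl
seq-sumℝ {suc m} t n = cong (_+_ (seq (t zero) n)) (seq-sumℝ (t ∘ suc) n)

rational : ∀ {d} → (Fin d → ℚ) → Point d
rational v j = fromℚ (v j)

rational-≗ : ∀ {d} {v v′ : Fin d → ℚ} → rational v ≋ rational v′ → ∀ j → v j ≡ v′ j
rational-≗ {v = v} {v′} v≋v′ j =
  let v≲v′ , v′≲v = ≈ℝ⇒≃ (fromℚ (v j)) (fromℚ (v′ j)) (v≋v′ j)
  in ℚ.≤-antisym (≲-const v≲v′) (≲-const v′≲v)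

sum-neg : ∀ {m} (f : Fin m → ℚ) → - sum f ≡ sum (λ k → - f k)
sum-neg {zero}  f = refl
sum-neg {suc m} f = trans (ℚ.neg-distrib-+ (f zero) _) (cong (_+_ (- f zero)) (sum-neg (f ∘ suc)))

-- A convex combination equal to `p` that remembers a label in `K` for each of its points.
-- Coordinates of labels are exact rationals, so properties of the points can be checked on labels;
-- the weights are plain sequences, nonnegative and of sum 1 only in the limit.
record Mixture {d} {K : Set} (u : K → Fin d → ℚ) (Q : Pred K 0ℓ) (p : Point d) : Set where
  field
    size     : ℕ
    κ        : Fin size → K
    weight   : Fin size → ℕ → ℚ
    κ∈Q      : ∀ k → κ k ∈ Q
    weight≥0 : ∀ k → const 0ℚ ≲ weight k
    weight≃1 : (λ n → sum (λ k → weight k n)) ≃ const 1ℚ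

  -- When `g κ` is a linear functional of the vector `u κ`, `mean g` is the value of that functional
  -- at `p`. The closure lemmas below build the needed functionals out of the coordinates.
  mean : (K → ℚ) → ℕ → ℚ
  mean g n = sum (λ k → weight k n * g (κ k))

  field
    coordinate : ∀ j → seq (p j) ≃ mean (λ κ → u κ j)

  mean-+ : ∀ {x y f g} → x ≃ mean f → y ≃ mean g → (λ n → x n + y n) ≃ mean (λ κ → f κ + g κ)
  mean-+ {x} {y} {f} {g} x≃f y≃g =
    ≃-trans {y = λ n → mean f n + mean g n} (≃-+ {x} {mean f} {y} {mean g} x≃f y≃g) (≗⇒≃ λ n →
      trans (sym (∑-distrib-+ (λ k → weight k n * f (κ k)) (λ k → weight k n * g (κ k))))
            (sum-cong-≗ λ k → sym (ℚ.*-distribˡ-+ (weight k n) (f (κ k)) (g (κ k)))))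

  mean-neg : ∀ {x f} → x ≃ mean f → (λ n → - x n) ≃ mean (λ κ → - f κ)
  mean-neg {x} {f} x≃f =
    ≃-trans {y = λ n → - mean f n} (≃-neg {x} {mean f} x≃f) (≗⇒≃ λ n →
      trans (sum-neg (λ k → weight k n * f (κ k)))
            (sum-cong-≗ λ k → ℚ.neg-distribʳ-* (weight k n) (f (κ k))))

  mean-scale : ∀ {x f} q → 0ℚ ≤ q → x ≃ mean f → (λ n → q * x n) ≃ mean (λ κ → q * f κ)
  mean-scale {x} {f} q 0≤q x≃f =
    ≃-trans {y = λ n → q * mean f n} (≃-scale {x} {mean f} q 0≤q x≃f) (≗⇒≃ λ n →
      trans (*-distribˡ-sum q (λ k → weight k n * f (κ k)))
            (sum-cong-≗ λ k → left-comm q (weight k n) (f (κ k))))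
    where
    left-comm : ∀ a b c → a * (b * c) ≡ b * (a * c)
    left-comm = solve 3 (λ a b c → a :* (b :* c) := b :* (a :* c)) refl
      where open +-*-Solver

  mean-sum : ∀ {m} {x : Fin m → ℕ → ℚ} {f : Fin m → K → ℚ} → (∀ j → x j ≃ mean (f j)) →
             (λ n → sum (λ j → x j n)) ≃ mean (λ κ → sum (λ j → f j κ))
  mean-sum {m} {x} {f} x≃f =
    ≃-trans {y = λ n → sum (λ j → mean (f j) n)} (≃-sum x≃f) (≗⇒≃ λ n →
      trans (∑-comm (λ j k → weight k n * f j (κ k)))
            (sum-cong-≗ λ k → sym (*-distribˡ-sum (weight k n) (λ j → f j (κ k)))))

  -- Individual terms of a weight sequence may be slightly negative, so the comparison is made
  -- termwise in `≲`: w f = w b + (f - b) w, where the constant f - b ≥ 0 scales 0 ≲ w. The terms w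
  -- b add up to b because the weights add up to 1.
  mean≥ : ∀ {x f} b → 0ℚ ≤ b → (∀ {κ} → κ ∈ Q → b ≤ f κ) → x ≃ mean f → const b ≲ x
  mean≥ {x} {f} b 0≤b b≤f (_ , f≲x) = begin
    const b
      ∼⟨ ≗⇒≲ (λ _ → sym (ℚ.*-identityʳ b)) ⟩
    (λ n → b * 1ℚ)
      ∼⟨ ≲-scale {y = λ n → sum (λ k → weight k n)} b 0≤b (proj₂ weight≃1) ⟩
    (λ n → b * sum (λ k → weight k n))
      ∼⟨ ≗⇒≲ (λ n → trans (ℚ.*-comm b _) (*-distribʳ-sum b (λ k → weight k n))) ⟩
    (λ n → sum (λ k → weight k n * b))
      ∼⟨ ≲-sum term ⟩
    mean f
      ∼⟨ f≲x ⟩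
    x ∎
    where
    open ≲-Reasoning
    open +-*-Solver
    term : ∀ k → (λ n → weight k n * b) ≲ (λ n → weight k n * f (κ k))
    term k = begin
      (λ n → weight k n * b)
        ∼⟨ ≗⇒≲ (λ n → sym (add-zero (weight k n * b) (f (κ k) - b))) ⟩
      (λ n → weight k n * b + (f (κ k) - b) * 0ℚ)
        ∼⟨ ≲-+ {λ n → weight k n * b} {λ n → weight k n * b} (≗⇒≲ λ _ → refl)
               (≲-scale {y = weight k} (f (κ k) - b) 0≤f-b (weight≥0 k)) ⟩
      (λ n → weight k n * b + (f (κ k) - b) * weight k n)
        ∼⟨ ≗⇒≲ (λ n → regroup (weight k n) (f (κ k)) b) ⟩
      (λ n → weight k n * f (κ k)) ∎
      where
      0≤f-b : 0ℚ ≤ f (κ k) - b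
      0≤f-b = subst (_≤ f (κ k) - b) (ℚ.+-inverseʳ b) (ℚ.+-monoˡ-≤ (- b) (b≤f (κ∈Q k)))
      add-zero : ∀ a c → a + c * 0ℚ ≡ a
      add-zero = solve 2 (λ a c → a :+ c :* con 0ℚ := a) refl
      regroup : ∀ w f b → w * b + (f - b) * w ≡ w * f
      regroup = solve 3 (λ w f b → w :* b :+ (f :- b) :* w := w :* f) refl

conv⇒mixture : ∀ {d} {K : Set} {u : K → Fin d → ℚ} {Q : Pred K 0ℓ} {S : Pred (Point d) 0ℓ} →
  (∀ s → s ∈ S → ∃ λ κ → κ ∈ Q × s ≋ rational (u κ)) → ∀ p → p ∈ conv S → Mixture u Q p
conv⇒mixture {u = u} index p (m , s , w , s∈S , w≥0 , Σw≈1 , p≋) = record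
  { size       = m
  ; κ          = λ k → proj₁ (index (s k) (s∈S k))
  ; weight     = λ k → seq (w k)
  ; κ∈Q        = λ k → proj₁ (proj₂ (index (s k) (s∈S k)))
  ; weight≥0   = w≥0
  ; weight≃1   = ≃-trans {y = seq (sumℝ w)} (≗⇒≃ λ n → sym (seq-sumℝ w n)) (≈ℝ⇒≃ (sumℝ w) 1ℝ Σw≈1)
  ; coordinate = λ j → ≃-trans {y = seq (sumℝ (λ k → w k *ℝ s k j))}
      (≈ℝ⇒≃ (p j) (sumℝ (λ k → w k *ℝ s k j)) (p≋ j))
      (≃-trans {y = λ n → sum (λ k → seq (w k) n * seq (s k j) n)} (≗⇒≃ (seq-sumℝ (λ k → w k *ℝ s k j)))
        (≃-sum λ k → ≈ℝ⇒≃ (w k *ℝ s k j) (w k *ℝ rational (u _) j)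
          (*ℝ-congˡ (w k) (s k j) (rational (u _) j) (proj₂ (proj₂ (index (s k) (s∈S k))) j))))
  }

rational∈conv : ∀ {d m} {S : Pred (Point d) 0ℓ} {v : Fin d → ℚ} (y : Fin m → Fin d → ℚ) (ω : Fin m → ℚ) →
  (∀ k → rational (y k) ∈ S) → (∀ k → 0ℚ ≤ ω k) → sum ω ≡ 1ℚ →
  (∀ j → v j ≡ sum (λ k → ω k * y k j)) → rational v ∈ conv S
rational∈conv y ω y∈S ω≥0 Σω≡1 v≡ =
  _ , rational ∘ y , fromℚ ∘ ω , y∈S , (λ k → ≤⇒≲ λ _ → ω≥0 k) ,
  ≃⇒≈ℝ (sumℝ (fromℚ ∘ ω)) 1ℝ (≗⇒≃ λ n → trans (seq-sumℝ (fromℚ ∘ ω) n) Σω≡1) ,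
  λ j → ≃⇒≈ℝ (fromℚ _) (sumℝ (λ k → fromℚ (ω k) *ℝ fromℚ (y k j))) (≗⇒≃ λ n →
    trans (v≡ j) (sym (seq-sumℝ (λ k → fromℚ (ω k) *ℝ fromℚ (y k j)) n)))

-- The points of X

ι : ℕ → ℚ
ι n = + n / 1

-- Division normalises by a gcd, which does not compute for a variable `n`; this canonical form
-- makes order and injectivity of `ι` readable.
ι≡mkℚ : ∀ n → ι n ≡ mkℚ (+ n) 0 (coprime-sym (1-coprimeTo n))
ι≡mkℚ n = ℚ.normalize-coprime _

1≤ι : ∀ n → 1ℚ ≤ ι (suc n)
1≤ι n = subst (1ℚ ≤_) (sym (ι≡mkℚ (suc n)))
  (*≤* (ℤ.*-monoʳ-≤-nonNeg (+ 1) {+ 1} {+ suc n} (ℤ.+≤+ (ℕ.s≤s ℕ.z≤n))))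

ι-injective : ∀ {m n} → ι m ≡ ι n → m ≡ n
ι-injective {m} {n} eq =
  ℤ.+-injective (proj₁ (ℚ.mkℚ-injective (trans (sym (ι≡mkℚ m)) (trans eq (ι≡mkℚ n)))))

0≤1 : 0ℚ ≤ 1ℚ
0≤1 = ℚ.nonNegative⁻¹ 1ℚ

1≰0 : ¬ 1ℚ ≤ 0ℚ
1≰0 1≤0 = ℚ.1≢0 (ℚ.≤-antisym 1≤0 0≤1)

0≤ι : ∀ n → 0ℚ ≤ ι (suc n)
0≤ι n = ℚ.≤-trans 0≤1 (1≤ι n)

0≤p*q : ∀ {p q} → 0ℚ ≤ p → 0ℚ ≤ q → 0ℚ ≤ p * q
0≤p*q {p} {q} 0≤p 0≤q = ℚ.nonNegative⁻¹ (p * q)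
  {{ℚ.nonNeg*nonNeg⇒nonNeg p {{nonNegative 0≤p}} q {{nonNegative 0≤q}}}}

sum-zero : ∀ {n} {f : Fin n → ℚ} → (∀ i → f i ≡ 0ℚ) → sum f ≡ 0ℚ
sum-zero {n} f≡0 = trans (sum-cong-≗ f≡0) (sum-replicate-zero n)

sum-single : ∀ {n} {f : Fin n → ℚ} i → (∀ j → j ≢ i → f j ≡ 0ℚ) → sum f ≡ f i
sum-single {suc n} {f} zero    f≡0 =
  trans (cong (_+_ (f zero)) (sum-zero λ j → f≡0 (suc j) λ ())) (ℚ.+-identityʳ _)
sum-single {suc n} {f} (suc i) f≡0 =
  trans (cong₂ _+_ (f≡0 zero λ ()) (sum-single i λ j j≢i → f≡0 (suc j) (j≢i ∘ Fin.suc-injective)))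
        (ℚ.+-identityˡ _)

sum≤0 : ∀ {n} {f : Fin n → ℚ} → (∀ i → f i ≤ 0ℚ) → sum f ≤ 0ℚ
sum≤0 {zero}  f≤0 = ℚ.≤-refl
sum≤0 {suc n} f≤0 = ℚ.+-mono-≤ (f≤0 zero) (sum≤0 (f≤0 ∘ suc))

sum≥0 : ∀ {n} {f : Fin n → ℚ} → (∀ i → 0ℚ ≤ f i) → 0ℚ ≤ sum f
sum≥0 {zero}  f≥0 = ℚ.≤-refl
sum≥0 {suc n} f≥0 = ℚ.+-mono-≤ (f≥0 zero) (sum≥0 (f≥0 ∘ suc))

-- The rational counterpart of `basis`, built on the same Boolean test so that `fromℚ` can be moved
-- through the conditional.
δ : ∀ {d} → Fin d → Fin d → ℚ
δ j j′ = if does (j Fin.≟ j′) then 1ℚ else 0ℚ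

δ-refl : ∀ {d} (j : Fin d) → δ j j ≡ 1ℚ
δ-refl j = cong (if_then 1ℚ else 0ℚ) (dec-true (j Fin.≟ j) refl)

δ-≢ : ∀ {d} {j j′ : Fin d} → j ≢ j′ → δ j j′ ≡ 0ℚ
δ-≢ {j = j} {j′} j≢j′ = cong (if_then 1ℚ else 0ℚ) (dec-false (j Fin.≟ j′) j≢j′)

-- inj₁ i stands for the point xⁱ of A, and inj₂ (j , k) for the point (k + 1) eʲ of A_j.
Site : ℕ → ℕ → Set
Site d m = Fin (suc m) ⊎ (Fin d × Fin m)

module _ {d m : ℕ} (c : Fin d → Fin (suc m)) where

  open Construction c

  u : Site d m → Fin d → ℚ
  u (inj₁ i)       j  = if does (i Fin.≟ c j) then 0ℚ else (ℤ.- index i) / 1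
  u (inj₂ (j , k)) j′ = ι (suc (toℕ k)) * δ j j′

  vertex-own : ∀ {i j} → i ≡ c j → u (inj₁ i) j ≡ 0ℚ
  vertex-own {i} {j} i≡cj = cong (if_then 0ℚ else _) (dec-true (i Fin.≟ c j) i≡cj)

  vertex-other : ∀ {i j} → i ≢ c j → u (inj₁ i) j ≡ - ι (suc (toℕ i))
  vertex-other {i} {j} i≢cj = cong (if_then 0ℚ else _) (dec-false (i Fin.≟ c j) i≢cj)

  vertex-neg≥0 : ∀ i j → 0ℚ ≤ - u (inj₁ i) j
  vertex-neg≥0 i j with i Fin.≟ c j
  ... | yes _ = ℚ.≤-refl
  ... | no _  = subst (0ℚ ≤_) (sym (neg-involutive (ι (suc (toℕ i))))) (0≤ι (toℕ i))

  vertex-neg≥1 : ∀ {i j} → i ≢ c j → 1ℚ ≤ - u (inj₁ i) j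
  vertex-neg≥1 {i} i≢cj = subst (1ℚ ≤_)
    (sym (trans (cong -_ (vertex-other i≢cj)) (neg-involutive (ι (suc (toℕ i)))))) (1≤ι (toℕ i))

  vertex≤0 : ∀ i j → u (inj₁ i) j ≤ 0ℚ
  vertex≤0 i j = subst (_≤ 0ℚ) (neg-involutive (u (inj₁ i) j)) (ℚ.neg-antimono-≤ (vertex-neg≥0 i j))

  axis-own : ∀ j k → u (inj₂ (j , k)) j ≡ ι (suc (toℕ k))
  axis-own j k = trans (cong (_*_ (ι (suc (toℕ k)))) (δ-refl j)) (ℚ.*-identityʳ _)

  axis-other : ∀ {j j′} k → j ≢ j′ → u (inj₂ (j , k)) j′ ≡ 0ℚ
  axis-other k j≢j′ = trans (cong (_*_ (ι (suc (toℕ k)))) (δ-≢ j≢j′)) (ℚ.*-zeroʳ (ι (suc (toℕ k))))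

  axis≥0 : ∀ j k j′ → 0ℚ ≤ u (inj₂ (j , k)) j′
  axis≥0 j k j′ with j Fin.≟ j′
  ... | yes refl = subst (0ℚ ≤_) (sym (ℚ.*-identityʳ (ι (suc (toℕ k))))) (0≤ι (toℕ k))
  ... | no  j≢j′ = ℚ.≤-reflexive (sym (ℚ.*-zeroʳ (ι (suc (toℕ k)))))

  axis-sum : ∀ j k → 1ℚ ≤ sum (u (inj₂ (j , k)))
  axis-sum j k = subst (1ℚ ≤_)
    (sym (trans (sum-single j λ j′ j′≢j → axis-other k (j′≢j ∘ sym)) (axis-own j k))) (1≤ι (toℕ k))

  X⇒site : ∀ p → p ∈ X → ∃ λ κ → p ≋ rational (u κ)
  X⇒site p (inj₁ (i , p≋x)) = inj₁ i , ≋-trans p (x i) (rational (u (inj₁ i))) p≋x λ j →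
    ≃⇒≈ℝ (x i j) (rational (u (inj₁ i)) j) (≗⇒≃ λ n →
      cong (λ y → seq y n) (sym (if-float fromℚ (does (i Fin.≟ c j)))))
  -- The multiple `suc k` of eʲ is stored as `k`, so the bound `suc k` ≤ r - 1 is exactly `k` < m.
  X⇒site p (inj₂ (j , suc k , _ , k<m , p≋)) =
    κ , ≋-trans p (λ j′ → fromℤ (+ suc k) *ℝ basis j j′) (rational (u κ)) p≋ λ j′ →
    ≃⇒≈ℝ (fromℤ (+ suc k) *ℝ basis j j′) (rational (u κ) j′) (≗⇒≃ λ n →
      cong₂ _*_ (cong (ι ∘ suc) (sym (Fin.toℕ-fromℕ< k<m)))
                (cong (λ y → seq y n) (sym (if-float fromℚ (does (j Fin.≟ j′))))))
    where
    κ : Site d m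
    κ = inj₂ (j , fromℕ< k<m)

  site∈X : ∀ κ → rational (u κ) ∈ X
  site∈X (inj₁ i) = inj₁ (i , λ j → ≃⇒≈ℝ (rational (u (inj₁ i)) j) (x i j) (≗⇒≃ λ n →
    cong (λ y → seq y n) (if-float fromℚ (does (i Fin.≟ c j)))))
  site∈X (inj₂ (j , k)) = inj₂ (j , suc (toℕ k) , ℕ.s≤s ℕ.z≤n , Fin.toℕ<n k , λ j′ →
    ≃⇒≈ℝ (rational (u (inj₂ (j , k))) j′) (fromℤ (+ suc (toℕ k)) *ℝ basis j j′) (≗⇒≃ λ n →
      cong (_*_ (ι (suc (toℕ k)))) (cong (λ y → seq y n) (if-float fromℚ (does (j Fin.≟ j′))))))

  -- Labellings of the sites whose classes have a common point in their hulls

  module Labelling {p : Point d} (label : Site d m → Fin (suc m))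
                   (mixture : ∀ i → Mixture u (λ κ → label κ ≡ i) p) where

    vertexLabel : Fin (suc m) → Fin (suc m)
    vertexLabel = label ∘ inj₁

    axisLabel : Fin d → Fin m → Fin (suc m)
    axisLabel j k = label (inj₂ (j , k))

    -- The m sites of axis `j` miss one of the m + 1 labels. In the class of that label every site
    -- has j-th coordinate at most 0, and the bound passes to `p`.
    p≲0 : ∀ j → seq (p j) ≲ const 0ℚ
    p≲0 j = begin
        seq (p j)              ∼⟨ ≗⇒≲ (λ n → sym (neg-involutive (seq (p j) n))) ⟩
        (λ n → - - seq (p j) n)
          ∼⟨ ≲-neg (mean≥ {f = λ κ → - u κ j} 0ℚ ℚ.≤-refl (λ {κ} → bound κ)
               (mean-neg {f = λ κ → u κ j} (coordinate j))) ⟩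
        const 0ℚ               ∎
      where
      open ≲-Reasoning
      i : Fin (suc m)
      i = proj₁ (misses (axisLabel j))
      open Mixture (mixture i)
      bound : ∀ κ → label κ ≡ i → 0ℚ ≤ - u κ j
      bound (inj₁ a)        _  = vertex-neg≥0 a j
      bound (inj₂ (j′ , k)) eq with j′ Fin.≟ j
      ... | yes refl = contradiction eq (proj₂ (misses (axisLabel j)) k)
      ... | no  j′≢j = subst (λ q → 0ℚ ≤ - q) (sym (ℚ.*-zeroʳ (ι (suc (toℕ k))))) ℚ.≤-refl

    Σp≲0 : (λ n → sum (λ j → seq (p j) n)) ≲ const 0ℚ
    Σp≲0 = begin
      (λ n → sum (λ j → seq (p j) n))  ∼⟨ ≲-sum p≲0 ⟩
      (λ n → sum {d} (λ _ → 0ℚ))       ∼⟨ ≗⇒≲ (λ _ → sum-replicate-zero d) ⟩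
      const 0ℚ                         ∎
      where open ≲-Reasoning

    -- A class made of axis sites alone has all coordinate sums at least 1, which would force the
    -- same for `p` against `Σp≲0`.
    vertexLabel-hits : ∀ i → ∃ λ a → vertexLabel a ≡ i
    vertexLabel-hits i with Fin.any? (λ a → vertexLabel a Fin.≟ i)
    ... | yes hit = hit
    ... | no miss = contradiction (≲-const (begin
        const 1ℚ
          ∼⟨ mean≥ {f = λ κ → sum (u κ)} 1ℚ 0≤1 (λ {κ} → bound κ) (mean-sum {f = λ j κ → u κ j} coordinate) ⟩
        (λ n → sum (λ j → seq (p j) n))
          ∼⟨ Σp≲0 ⟩
        const 0ℚ ∎)) 1≰0
      where
      open ≲-Reasoning
      open Mixture (mixture i)
      bound : ∀ κ → label κ ≡ i → 1ℚ ≤ sum (u κ)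
      bound (inj₁ a)       eq = contradiction (a , eq) miss
      bound (inj₂ (j , k)) _  = axis-sum j k

    vertexPermutation : ∃ λ (σ : Permutation′ (suc m)) → ∀ a → vertexLabel a ≡ σ ⟨$⟩ʳ a
    vertexPermutation = covers⇒permutation vertexLabel id id vertexLabel-hits

    σ : Permutation′ (suc m)
    σ = proj₁ vertexPermutation

    vertexLabel-injective : Injective _≡_ _≡_ vertexLabel
    vertexLabel-injective {a} {b} eq = σ-injective (trans (sym (proj₂ vertexPermutation a))
      (trans eq (proj₂ vertexPermutation b)))
      where
      σ-injective : σ ⟨$⟩ʳ a ≡ σ ⟨$⟩ʳ b → a ≡ b
      σ-injective eq = trans (sym (inverseˡ σ)) (trans (cong (σ ⟨$⟩ˡ_) eq) (inverseˡ σ))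

    -- In the class of the vertex with index `c j` there is no other vertex, by injectivity. Its own
    -- j-th coordinate is 0 and axis sites have nonnegative coordinates.
    0≲p : ∀ j → const 0ℚ ≲ seq (p j)
    0≲p j = mean≥ {f = λ κ → u κ j} 0ℚ ℚ.≤-refl (λ {κ} → bound κ) (coordinate j)
      where
      open Mixture (mixture (vertexLabel (c j)))
      bound : ∀ κ → label κ ≡ vertexLabel (c j) → 0ℚ ≤ u κ j
      bound (inj₁ a)        eq = ℚ.≤-reflexive (sym (vertex-own (vertexLabel-injective eq)))
      bound (inj₂ (j′ , k)) _  = axis≥0 j′ k j

    -- Otherwise y ↦ Σ_l y_l − C y_j is at least 1 on the part of xⁱ (C makes it so at xⁱ, as xⁱ_j ≤ −1),
    -- although it is at most 0 at p.
    axisLabel-hits : ∀ {i j} → i ≢ c j → ∃ λ k → axisLabel j k ≡ vertexLabel i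
    axisLabel-hits {i} {j} i≢cj with Fin.any? (λ k → axisLabel j k Fin.≟ vertexLabel i)
    ... | yes hit = hit
    ... | no miss = contradiction (≲-const (begin
        const 1ℚ
          ∼⟨ mean≥ {f = functional} 1ℚ 0≤1 (λ {κ} → bound κ)
               (mean-+ {f = λ κ → sum (u κ)} {λ κ → C * - u κ j} (mean-sum {f = λ j κ → u κ j} coordinate)
                 (mean-scale {f = λ κ → - u κ j} C 0≤C (mean-neg {f = λ κ → u κ j} (coordinate j)))) ⟩
        (λ n → sum (λ j → seq (p j) n) + C * - seq (p j) n)
          ∼⟨ ≲-+ {y = const 0ℚ} {y′ = λ n → C * 0ℚ} Σp≲0
               (≲-scale {y = const 0ℚ} C 0≤C (≲-neg {x = const 0ℚ} (0≲p j))) ⟩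
        (λ n → 0ℚ + C * 0ℚ)
          ∼⟨ ≗⇒≲ (λ _ → trans (ℚ.+-identityˡ _) (ℚ.*-zeroʳ C)) ⟩
        const 0ℚ ∎)) 1≰0
      where
      open ≲-Reasoning
      open Mixture (mixture (vertexLabel i))
      C : ℚ
      C = 1ℚ - sum (u (inj₁ i))
      0≤C : 0ℚ ≤ C
      0≤C = ℚ.+-mono-≤ 0≤1 (ℚ.neg-antimono-≤ (sum≤0 (vertex≤0 i)))
      functional : Site d m → ℚ
      functional κ = sum (u κ) + C * - u κ j
      bound : ∀ κ → label κ ≡ vertexLabel i → 1ℚ ≤ functional κ
      bound (inj₁ a) eq with refl ← vertexLabel-injective eq =
        subst (_≤ functional (inj₁ a)) (cancel (sum (u (inj₁ a)))) (ℚ.+-monoʳ-≤ (sum (u (inj₁ a)))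
          (ℚ.*-monoˡ-≤-nonNeg C {{nonNegative 0≤C}} (vertex-neg≥1 i≢cj)))
        where
        cancel : ∀ s → s + (1ℚ - s) * 1ℚ ≡ 1ℚ
        cancel = solve 1 (λ s → s :+ (con 1ℚ :- s) :* con 1ℚ := con 1ℚ) refl
          where open +-*-Solver
      bound (inj₂ (j′ , k)) eq = subst (1ℚ ≤_) (sym functional≡s) (axis-sum j′ k)
        where
        s : ℚ
        s = sum (u (inj₂ (j′ , k)))
        j′≢j : j′ ≢ j
        j′≢j refl = miss (k , eq)
        functional≡s : s + C * - u (inj₂ (j′ , k)) j ≡ s
        functional≡s = trans (cong (λ q → s + C * - q) (axis-other k j′≢j))
                        (trans (cong (_+_ s) (ℚ.*-zeroʳ C)) (ℚ.+-identityʳ s))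

    -- `punchIn (c j)` enumerates the m indices other than `c j`. The m sites of axis `j` hit all
    -- the classes of these vertices, hence each exactly once and no other class.
    axisPermutation : ∀ j → ∃ λ (π : Permutation′ m) → ∀ k → axisLabel j k ≡ vertexLabel (punchIn (c j) (π ⟨$⟩ʳ k))
    axisPermutation j = covers⇒permutation (axisLabel j) (vertexLabel ∘ punchIn (c j))
      (Fin.punchIn-injective (c j) _ _ ∘ vertexLabel-injective)
      (λ k → axisLabel-hits (Fin.punchInᵢ≢i (c j) k))

  -- At least one coordinate is needed to tell the points of A apart.
  u-injective : Fin d → ∀ κ κ′ → (∀ j → u κ j ≡ u κ′ j) → κ ≡ κ′
  u-injective j₀ (inj₁ i) (inj₁ i′) eq with i Fin.≟ c j₀ | i′ Fin.≟ c j₀ | eq j₀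
  ... | yes i≡c | yes i′≡c | _  = cong inj₁ (trans i≡c (sym i′≡c))
  ... | yes _   | no _     | 0≡ = contradiction
    (subst (1ℚ ≤_) (ℚ.neg-injective {ι (suc (toℕ i′))} {0ℚ} (sym 0≡)) (1≤ι (toℕ i′))) 1≰0
  ... | no _    | yes _    | ≡0 = contradiction
    (subst (1ℚ ≤_) (ℚ.neg-injective {ι (suc (toℕ i))} {0ℚ} ≡0) (1≤ι (toℕ i))) 1≰0
  ... | no _    | no _     | e  = cong inj₁ (Fin.toℕ-injective (ℕ.suc-injective (ι-injective (ℚ.neg-injective e))))
  u-injective j₀ (inj₁ i) (inj₂ (j , k)) eq = contradiction (u-injective j₀ (inj₂ (j , k)) (inj₁ i) (sym ∘ eq)) λ ()
  u-injective j₀ (inj₂ (j , k)) (inj₁ i) eq = contradiction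
    (ℚ.≤-trans (1≤ι (toℕ k)) (subst (_≤ 0ℚ) (trans (sym (eq j)) (axis-own j k)) (vertex≤0 i j))) 1≰0
  u-injective j₀ (inj₂ (j , k)) (inj₂ (j′ , k′)) eq with j′ Fin.≟ j
  ... | yes refl = cong (λ k → inj₂ (j , k)) (Fin.toℕ-injective (ℕ.suc-injective (ι-injective
    (trans (sym (axis-own j k)) (trans (eq j) (axis-own j k′))))))
  ... | no j′≢j = contradiction
    (subst (1ℚ ≤_) (trans (sym (axis-own j k)) (trans (eq j) (axis-other k′ j′≢j))) (1≤ι (toℕ k))) 1≰0

  -- The Tverberg partition given by one permutation for each axis

  module Partition (e : Fin d → Permutation′ m) where

    -- Sending xⁱ to part `i` fixes the numbering of the parts; `e j` then distributes the sites of
    -- axis `j` over the indices other than `c j`.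
    label : Site d m → Fin (suc m)
    label (inj₁ i)       = i
    label (inj₂ (j , k)) = punchIn (c j) (e j ⟨$⟩ʳ k)

    block : Fin (suc m) → Pred (Point d) 0ℓ
    block i p = ∃ λ κ → label κ ≡ i × p ≋ rational (u κ)

    -- Finds in part `i` the weighted point that cancels the j-th coordinate of xⁱ and leaves the
    -- other coordinates unchanged.
    cancelling-site : ∀ i j → ∃ λ κ → label κ ≡ i ×
      ∃ λ ω → 0ℚ ≤ ω × ∀ j′ → ω * u κ j′ ≡ - u (inj₁ i) j * δ j j′
    cancelling-site i j with c j Fin.≟ i
    -- Here the j-th coordinate of xⁱ is already 0, so xⁱ itself with weight 0 serves as a filler.
    ... | yes cj≡i = inj₁ i , refl , 0ℚ , ℚ.≤-refl , λ j′ →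
      trans (ℚ.*-zeroˡ (u (inj₁ i) j′))
            (sym (trans (cong (λ q → - q * δ j j′) (vertex-own (sym cj≡i))) (ℚ.*-zeroˡ (δ j j′))))
    -- The inverse of `e j` finds the only site K eʲ of axis `j` in part `i`; its weight is the
    -- absolute value of the coordinate divided by K.
    ... | no cj≢i = inj₂ (j , k)
      , trans (cong (punchIn (c j)) (inverseʳ (e j))) (Fin.punchIn-punchOut cj≢i)
      , - v * 1/ K , 0≤p*q (vertex-neg≥0 i j) (ℚ.<⇒≤ (ℚ.positive⁻¹ (1/ K) {{ℚ.1/pos⇒pos K}})) , λ j′ →
        trans (regroup (- v) (1/ K) K (δ j j′))
              (trans (cong (λ q → - v * q * δ j j′) (ℚ.*-inverseˡ K)) (cong (_* δ j j′) (ℚ.*-identityʳ (- v))))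
      where
      k : Fin m
      k = e j ⟨$⟩ˡ punchOut cj≢i
      v K : ℚ
      v = u (inj₁ i) j
      K = ι (suc (toℕ k))
      instance
        K>0 : Positive K
        K>0 = positive (ℚ.<-≤-trans (ℚ.positive⁻¹ 1ℚ) (1≤ι (toℕ k)))
        K≢0 : NonZero K
        K≢0 = ℚ.pos⇒nonZero K
      regroup : ∀ a b c d → (a * b) * (c * d) ≡ a * (b * c) * d
      regroup = solve 4 (λ a b c d → (a :* b) :* (c :* d) := a :* (b :* c) :* d) refl
        where open +-*-Solver

    -- xⁱ + Σⱼ ωⱼ (kⱼ eʲ) = 0; the weights 1, ω₁, …, ω_d are divided by their sum T.
    0∈conv : ∀ i → rational (λ _ → 0ℚ) ∈ conv (block i)
    0∈conv i = rational∈conv {S = block i} (u ∘ site) (λ k → 1/ T * W k)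
      (λ k → site k , site∈i k , ≋-refl (rational (u (site k))))
      (λ k → 0≤p*q (ℚ.<⇒≤ (ℚ.positive⁻¹ (1/ T) {{ℚ.1/pos⇒pos T}})) (W≥0 k))
      (trans (sym (*-distribˡ-sum (1/ T) W)) (ℚ.*-inverseˡ T))
      λ j → sym (begin
        sum (λ k → 1/ T * W k * u (site k) j)    ≡⟨ sum-cong-≗ (λ k → ℚ.*-assoc (1/ T) (W k) (u (site k) j)) ⟩
        sum (λ k → 1/ T * (W k * u (site k) j))  ≡⟨ *-distribˡ-sum (1/ T) (λ k → W k * u (site k) j) ⟨
        1/ T * sum (λ k → W k * u (site k) j)    ≡⟨ cong (_*_ (1/ T)) (balanced j) ⟩
        1/ T * 0ℚ                                ≡⟨ ℚ.*-zeroʳ (1/ T) ⟩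
        0ℚ                                       ∎)
      where
      open ≡-Reasoning
      ω : Fin d → ℚ
      ω j = let _ , _ , ωⱼ , _ = cancelling-site i j in ωⱼ
      ω≥0 : ∀ j → 0ℚ ≤ ω j
      ω≥0 j = let _ , _ , _ , ωⱼ≥0 , _ = cancelling-site i j in ωⱼ≥0
      site : Fin (suc d) → Site d m
      site zero    = inj₁ i
      site (suc j) = proj₁ (cancelling-site i j)
      site∈i : ∀ k → label (site k) ≡ i
      site∈i zero    = refl
      site∈i (suc j) = proj₁ (proj₂ (cancelling-site i j))
      cancels : ∀ j j′ → ω j * u (site (suc j)) j′ ≡ - u (inj₁ i) j * δ j j′
      cancels j = let _ , _ , _ , _ , eq = cancelling-site i j in eq
      W : Fin (suc d) → ℚ
      W zero    = 1ℚ
      W (suc j) = ω j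
      W≥0 : ∀ k → 0ℚ ≤ W k
      W≥0 zero    = 0≤1
      W≥0 (suc j) = ω≥0 j
      T : ℚ
      T = sum W
      instance
        T>0 : Positive T
        T>0 = positive (ℚ.+-mono-<-≤ (ℚ.positive⁻¹ 1ℚ) (sum≥0 ω≥0))
        T≢0 : NonZero T
        T≢0 = ℚ.pos⇒nonZero T
      balanced : ∀ j → sum (λ k → W k * u (site k) j) ≡ 0ℚ
      balanced j = begin
        1ℚ * v + sum (λ j′ → ω j′ * u (site (suc j′)) j)
          ≡⟨ cong₂ _+_ (ℚ.*-identityˡ v) (sum-cong-≗ λ j′ → cancels j′ j) ⟩
        v + sum (λ j′ → - u (inj₁ i) j′ * δ j′ j)
          ≡⟨ cong (_+_ v) (sum-single j λ j′ j′≢j →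
               trans (cong (_*_ (- u (inj₁ i) j′)) (δ-≢ j′≢j)) (ℚ.*-zeroʳ (- u (inj₁ i) j′))) ⟩
        v + - v * δ j j
          ≡⟨ cong (_+_ v) (trans (cong (_*_ (- v)) (δ-refl j)) (ℚ.*-identityʳ (- v))) ⟩
        v - v
          ≡⟨ ℚ.+-inverseʳ v ⟩
        0ℚ ∎
        where
        v : ℚ
        v = u (inj₁ i) j

    -- The argument `j₀` witnesses d ≥ 1. It lets equal points be traced back to equal sites, and
    -- disjointness follows because a site has a single label.
    partition : Fin d → TverbergPartition (suc m) X
    partition j₀ = record
      { part     = block
      ; respects = λ i {p} {q} p≋q (κ , κ∈i , p≋κ) →
          κ , κ∈i , ≋-trans q p (rational (u κ)) (≋-sym p q p≋q) p≋κ
      ; disjoint = λ {_} {_} {p} (κ , κ∈i , p≋κ) (κ′ , κ′∈i′ , p≋κ′) → trans (sym κ∈i) (trans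
          (cong label (u-injective j₀ κ κ′ (rational-≗ {v = u κ} {u κ′} (≋-trans (rational (u κ)) p (rational (u κ′))
            (≋-sym p (rational (u κ)) p≋κ) p≋κ′))))
          κ′∈i′)
      ; union    = (λ {p} (i , κ , _ , p≋κ) → X-respects p (rational (u κ)) p≋κ (site∈X κ))
                 , λ {p} p∈X → let κ , p≋κ = X⇒site p p∈X in label κ , κ , refl , p≋κ
      ; common   = rational (λ _ → 0ℚ) , 0∈conv
      }
      where
      X-respects : ∀ p q → p ≋ q → q ∈ X → p ∈ X
      X-respects p q p≋q (inj₁ (i , q≋))               = inj₁ (i , ≋-trans p q (x i) p≋q q≋)
      X-respects p q p≋q (inj₂ (j , k , 1≤k , k≤ , q≋)) =
        inj₂ (j , k , 1≤k , k≤ , ≋-trans p q (λ j′ → fromℤ (+ k) *ℝ basis j j′) p≋q q≋)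

  -- The correspondence between families of permutations and unordered partitions

  partition-injective : ∀ j₀ e e′ → Partition.partition e j₀ ∼ Partition.partition e′ j₀ →
                        ∀ j → e j Perm.≈ e′ j
  partition-injective j₀ e e′ (π , e≐e′) j k = Fin.punchIn-injective (c j) _ _
    (trans (sym (π-fixes (E.label κ))) (sym (label≡ κ)))
    where
    module E = Partition e
    module E′ = Partition e′
    κ : Site d m
    κ = inj₂ (j , k)
    label≡ : ∀ κ → E′.label κ ≡ π ⟨$⟩ʳ E.label κ
    label≡ κ = let κ′ , κ′∈ , κ≋κ′ = proj₁ (e≐e′ (E.label κ)) {rational (u κ)} (κ , refl , ≋-refl (rational (u κ)))
               in trans (cong E′.label (u-injective j₀ κ κ′ (rational-≗ {v = u κ} {u κ′} κ≋κ′))) κ′∈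
    -- In both partitions xⁱ lies in part `i`, so no renumbering other than the identity can match
    -- them.
    π-fixes : ∀ i → π ⟨$⟩ʳ i ≡ i
    π-fixes i = sym (label≡ (inj₁ i))

  module Surjectivity (P : TverbergPartition (suc m) X) where

    label : Site d m → Fin (suc m)
    label κ = proj₁ (proj₂ (union P) {rational (u κ)} (site∈X κ))

    site∈part : ∀ κ → rational (u κ) ∈ part P (label κ)
    site∈part κ = proj₂ (proj₂ (union P) {rational (u κ)} (site∈X κ))

    -- The site equal to `p` lies both in part `i` and in the part named by its label, so
    -- disjointness identifies the two indices.
    part⇒site : ∀ i p → p ∈ part P i → ∃ λ κ → label κ ≡ i × p ≋ rational (u κ)
    part⇒site i p p∈i =
      let κ , p≋κ = X⇒site p (proj₁ (union P) {p} (i , p∈i))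
      in κ , disjoint P {p = rational (u κ)} (site∈part κ) (respects P i {p} {rational (u κ)} p≋κ p∈i) , p≋κ

    site⇒part : ∀ p κ → p ≋ rational (u κ) → p ∈ part P (label κ)
    site⇒part p κ p≋κ = respects P (label κ) {rational (u κ)} {p} (≋-sym p (rational (u κ)) p≋κ) (site∈part κ)

    open Labelling label (λ i → conv⇒mixture (part⇒site i) (proj₁ (common P)) (proj₂ (common P) i))
      using (σ; vertexPermutation; axisPermutation)

    e : Fin d → Permutation′ m
    e j = proj₁ (axisPermutation j)

    -- The labels in `P` are those of the constructed partition followed by `σ`, so `σ` is the
    -- renumbering. Pointwise agreement of `e′` with `e` is assumed because a code determines its
    -- permutations only up to that.
    covered : ∀ j₀ e′ → (∀ j → e′ j Perm.≈ e j) → Partition.partition e′ j₀ ∼ P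
    covered j₀ e′ e′≈e = σ , λ i →
        (λ {p} (κ , κ∈i , p≋κ) → subst (λ i → p ∈ part P i) (trans (label≡ κ) (cong (σ ⟨$⟩ʳ_) κ∈i)) (site⇒part p κ p≋κ))
      , λ {p} p∈ → let κ , κ∈ , p≋κ = part⇒site _ p p∈
               in κ , trans (sym (inverseˡ σ)) (trans (cong (σ ⟨$⟩ˡ_) (trans (sym (label≡ κ)) κ∈)) (inverseˡ σ)) , p≋κ
      where
      module E′ = Partition e′
      label≡ : ∀ κ → label κ ≡ σ ⟨$⟩ʳ E′.label κ
      label≡ (inj₁ a)       = proj₂ vertexPermutation a
      label≡ (inj₂ (j , k)) = trans (proj₂ (axisPermutation j) k) (trans (proj₂ vertexPermutation _)
        (cong (λ i → σ ⟨$⟩ʳ punchIn (c j) i) (sym (e′≈e j k))))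

proposition3p4 : (d r : ℕ) → 1 ℕ.≤ d → 1 ℕ.≤ r →
    (n : ℕ) → n ≡ (d ℕ.+ 1) ℕ.* (r ∸ 1) ℕ.+ 1 →
    (a : Fin r → ℤ) → (∀ i → a i ℤ.≤ + (d ℕ.+ 1)) → sumℤ a ≡ + n →
    (c : Fin d → Fin r) → (∀ i → + (#fibre c i) ≡ + (d ℕ.+ 1) ℤ.- a i) →
    Bijection (setoid (Fin (((r ∸ 1) !) ^ d))) (TverbergPartitions r (Construction.X c))
-- Since d is a successor, `zero` supplies the coordinate that separates the points of A; with r =
-- `suc m`, the number (r - 1)! is `m !`.
proposition3p4 d@(suc _) (suc m) _ _ _ _ _ _ _ c _ = record
  { to        = to
  ; cong      = λ { {z} refl → Setoid.refl (TverbergPartitions (suc m) (Construction.X c)) {to z} }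
  ; bijective = (λ {y} {z} y∼z → toPermutations-injective m d
                  (partition-injective c zero (toPermutations m d y) (toPermutations m d z) y∼z))
              , λ P → let open Surjectivity c P
                          z , z≈e = toPermutations-surjective m d e
                      in z , λ { refl → covered zero (toPermutations m d z) z≈e }
  }
  where
  to : Fin ((m !) ^ d) → TverbergPartition (suc m) (Construction.X c)
  to z = Partition.partition c (toPermutations m d z) zero
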